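{- Let $\phi\vdash\psi$ be an $\mathcal{L}_{\mathrm{SI}}$-sequent and $\chi\vdash\delta$ an $\mathcal{L}_\bullet$-sequent. If the rule $$\frac{\Rightarrow\phi\vdash\psi}{\Rightarrow\chi\vdash\delta}$$ is derivable in $\mathsf{ALC}$, then $\phi\vdash\psi$ algebraically corresponds to $\chi\vdash\delta$ over BDRGs, i.e. the two sequents are valid in exactly the same BDRGs.
   Context: Languages. Formulas are built from propositional variables and the constants $\top,\bot$: $\mathcal{L}_{\mathrm{SI}}$ uses $\wedge,\vee,\to$; $\mathcal{L}_{\mathrm{LC}}$ uses $\wedge,\vee,\to,\bullet,\leftarrow$; $\mathcal{L}_\bullet$ uses only $\bullet$. A sequent is $\phi\vdash\psi$ with $\phi,\psi$ formulas; an $\mathcal{L}_{\mathrm{LC}}$-supersequent is $\Theta\Rightarrow\chi\vdash\delta$ with $\Theta$ a set of $\mathcal{L}_{\mathrm{LC}}$-sequents (written without $\Theta$ if it is empty). A BDRG is an algebra $(A,\wedge,\vee,\top,\bot,\to,\bullet,\leftarrow)$ such that $(A,\wedge,\vee,\top,\bot)$ is a bounded distributive lattice and, for all $a,b,c\in A$: $a\bullet b\le c$ iff $b\le a\to c$ iff $a\le c\leftarrow b$. A sequent $\phi\vdash\psi$ is valid in a BDRG if $\mu(\phi)\le\mu(\psi)$ for every assignment $\mu$. Calculus $\mathsf{ALC}$. It acts on $\mathcal{L}_{\mathrm{LC}}$-supersequents; in each rule $S/\!/S'$ below, $S$ and $S'$ may be derived from each other. A rule is derivable in $\mathsf{ALC}$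 if its conclusion has a derivation from its premiss using only rules of $\mathsf{ALC}$. Rules changing only one assumption (the rest $\Theta\Rightarrow\chi\vdash\delta$ is unchanged): Splitting: $\gamma\vdash\phi\wedge\psi$ $/\!/$ $\gamma\vdash\phi,\ \gamma\vdash\psi$; $\phi\vee\psi\vdash\gamma$ $/\!/$ $\phi\vdash\gamma,\ \psi\vdash\gamma$. Residuation: $\psi\vdash\phi\to\gamma$ $/\!/$ $\phi\bullet\psi\vdash\gamma$; $\phi\vdash\gamma\leftarrow\psi$ $/\!/$ $\phi\bullet\psi\vdash\gamma$. Approximation, with $p$ a fresh variable (not occurring in the previous derivation): $\phi\to\psi\vdash\gamma$ $/\!/$ $p\vdash\phi,\ p\to\psi\vdash\gamma$; $\phi\to\psi\vdash\gamma$ $/\!/$ $\psi\vdash p,\ \phi\to p\vdash\gamma$; $\gamma\vdash\phi\to\psi$ $/\!/$ $\phi\vdash p,\ \gamma\vdash p\to\psi$; $\gamma\vdash\phi\to\psi$ $/\!/$ $p\vdash\psi,\ \gamma\vdash\phi\to p$; $\phi\vdash\psi\bullet\gamma$ $/\!/$ $p\vdash\psi,\ \phi\vdash p\bullet\gamma$; $\phi\vdash\psi\bullet\gamma$ $/\!/$ $p\vdash\gamma,\ \phi\vdash\psi\bullet p$; $\phi\bullet\psi\vdash\gamma$ $/\!/$ $\phi\vdash p,\ p\bullet\psi\vdash\gamma$; $\phi\bullet\psi\vdash\gamma$ $/\!/$ $\psi\vdash p,\ \phi\bullet p\vdash\gamma$; $\phi\wedge\psi\vdash\gamma$ $/\!/$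 $\phi\vdash p,\ p\wedge\psi\vdash\gamma$; $\phi\wedge\psi\vdash\gamma$ $/\!/$ $\psi\vdash p,\ \phi\wedge p\vdash\gamma$; $\phi\vdash\psi\vee\gamma$ $/\!/$ $p\vdash\psi,\ \phi\vdash p\vee\gamma$; $\phi\vdash\psi\vee\gamma$ $/\!/$ $p\vdash\gamma,\ \phi\vdash\psi\vee p$. Rules involving the conclusion: $\Theta\Rightarrow\psi\vdash\phi\to\gamma$ $/\!/$ $\Theta\Rightarrow\phi\bullet\psi\vdash\gamma$; $\Theta\Rightarrow\phi\vdash\gamma\leftarrow\psi$ $/\!/$ $\Theta\Rightarrow\phi\bullet\psi\vdash\gamma$; and for fresh $p$: $\Theta\Rightarrow\phi\vdash\psi$ $/\!/$ $p\vdash\phi,\Theta\Rightarrow p\vdash\psi$; $\Theta\Rightarrow\phi\vdash\psi$ $/\!/$ $\psi\vdash p,\Theta\Rightarrow\phi\vdash p$. Ackermann rules: (RAck) $\phi_1\vdash p,\dots,\phi_n\vdash p,\Theta,\Theta'\Rightarrow\chi\vdash\delta$ $/\!/$ $\Theta[\alpha/p],\Theta'\Rightarrow(\chi\vdash\delta)[\alpha/p]$ with $\alpha=\bigvee_{i=1}^n\phi_i$, provided $p$ does not occur in $\Theta'$ or any $\phi_i$, each sequent $\psi_j\vdash\gamma_j$ in the finite set $\Theta$ has $\psi_j$ positive and $\gamma_j$ negative in $p$, and either $p$ does not occur in $\chi\vdash\delta$ or $\chi\vdash\delta$ is positive in $p$ ($\chi$ negative and $\delta$ positive in $p$). (LAck)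 $p\vdash\phi_1,\dots,p\vdash\phi_n,\Theta,\Theta'\Rightarrow\chi\vdash\delta$ $/\!/$ $\Theta[\alpha/p],\Theta'\Rightarrow(\chi\vdash\delta)[\alpha/p]$ with $\alpha=\bigwedge_{i=1}^n\phi_i$, provided $p$ does not occur in $\Theta'$ or any $\phi_i$, each $\psi_j\vdash\gamma_j$ in the finite set $\Theta$ has $\psi_j$ negative and $\gamma_j$ positive in $p$, and either $p$ does not occur in $\chi\vdash\delta$ or $\chi\vdash\delta$ is negative in $p$ ($\chi$ positive and $\delta$ negative in $p$). -}

module Defs where

open import Level using (Level; 0ℓ; _⊔_) renaming (suc to lsuc)
open import Data.Empty using () renaming (⊥ to 𝟘)
open import Data.Unit using () renaming (⊤ to 𝟙)
open import Data.Bool using (if_then_else_)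
open import Data.List using (List; []; _∷_; map)
open import Data.List.Membership.Propositional using () renaming (_∈_ to _∈ˡ_)
open import Data.List.Relation.Unary.All using (All)
open import Data.Nat using (ℕ; _≟_)
open import Data.Product using (Σ-syntax; _×_)
open import Data.Sum using (_⊎_)
open import Function.Bundles using (_⇔_)
open import Relation.Binary.Core using (Rel)
open import Relation.Binary.Lattice using (IsBoundedLattice)
open import Relation.Binary.PropositionalEquality using (_≡_; _≢_)
open import Relation.Nullary using (¬_; does)
open import Relation.Unary using (Pred; _∈_; _∪_; ∅; ｛_｝; _≐_)
open import Algebra.Core using (Op₂)
import Algebra.Definitions

record BDRG (c ℓ₁ ℓ₂ : Level) : Set (lsuc (c ⊔ ℓ₁ ⊔ ℓ₂)) where
  infix  4 _≈_ _≤_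
  infixr 7 _∧_
  infixr 6 _∨_
  infixr 5 _⇾_
  infixl 5 _⇽_
  infixl 8 _•_
  field
    Carrier          : Set c
    _≈_              : Rel Carrier ℓ₁
    _≤_              : Rel Carrier ℓ₂
    _∧_ _∨_          : Op₂ Carrier
    ⊤ ⊥              : Carrier
    _⇾_ _•_ _⇽_      : Op₂ Carrier
    isBoundedLattice : IsBoundedLattice _≈_ _≤_ _∨_ _∧_ ⊤ ⊥
    ∧-distribˡ-∨     : Algebra.Definitions._DistributesOverˡ_ _≈_ _∧_ _∨_
    -- Congruence of ⇾, • and ⇽ for ≈ follows from these two laws.
    residual-⇾       : ∀ a b c → (a • b ≤ c) ⇔ (b ≤ a ⇾ c)
    residual-⇽       : ∀ a b c → (a • b ≤ c) ⇔ (a ≤ c ⇽ b)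

Var : Set
Var = ℕ

infixr 7 _∧_
infixr 6 _∨_
infixr 5 _⇾_
infixl 5 _⇽_
infixl 8 _•_
infix  4 _⊢_
infix  3 _⇒_

-- The full language, with → and ← written ⇾ and ⇽.
data Formula : Set where
  var                     : Var → Formula
  ⊤ ⊥                     : Formula
  _∧_ _∨_ _⇾_ _•_ _⇽_     : Formula → Formula → Formula

data SIFormula : Formula → Set where
  var : ∀ p → SIFormula (var p)
  ⊤   : SIFormula ⊤
  ⊥   : SIFormula ⊥
  _∧_ : ∀ {φ ψ} → SIFormula φ → SIFormula ψ → SIFormula (φ ∧ ψ)
  _∨_ : ∀ {φ ψ} → SIFormula φ → SIFormula ψ → SIFormula (φ ∨ ψ)
  _⇾_ : ∀ {φ ψ} → SIFormula φ → SIFormula ψ → SIFormula (φ ⇾ ψ)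

data •Formula : Formula → Set where
  var : ∀ p → •Formula (var p)
  ⊤   : •Formula ⊤
  ⊥   : •Formula ⊥
  _•_ : ∀ {φ ψ} → •Formula φ → •Formula ψ → •Formula (φ • ψ)

record Sequent : Set where
  constructor _⊢_
  field
    antecedent : Formula
    succedent  : Formula

SISequent : Sequent → Set
SISequent (φ ⊢ ψ) = SIFormula φ × SIFormula ψ

•Sequent : Sequent → Set
•Sequent (φ ⊢ ψ) = •Formula φ × •Formula ψ

record Supersequent : Set₁ where
  constructor _⇒_
  field
    assumptions : Pred Sequent 0ℓ
    conclusion  : Sequent

-- Supersequents with extensionally equal sets of assumptions are the same.
_≋_ : Supersequent → Supersequent → Set
(Θ ⇒ s) ≋ (Θ′ ⇒ s′) = Θ ≐ Θ′ × s ≡ s′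

⟨_⟩ : List Sequent → Pred Sequent 0ℓ
⟨ Γ ⟩ s = s ∈ˡ Γ

module _ {c ℓ₁ ℓ₂} (A : BDRG c ℓ₁ ℓ₂) where
  private module A = BDRG A

  ⟦_⟧ : Formula → (Var → A.Carrier) → A.Carrier
  ⟦ var p ⟧ μ = μ p
  ⟦ ⊤ ⟧     μ = A.⊤
  ⟦ ⊥ ⟧     μ = A.⊥
  ⟦ φ ∧ ψ ⟧ μ = ⟦ φ ⟧ μ A.∧ ⟦ ψ ⟧ μ
  ⟦ φ ∨ ψ ⟧ μ = ⟦ φ ⟧ μ A.∨ ⟦ ψ ⟧ μ
  ⟦ φ ⇾ ψ ⟧ μ = ⟦ φ ⟧ μ A.⇾ ⟦ ψ ⟧ μ
  ⟦ φ • ψ ⟧ μ = ⟦ φ ⟧ μ A.• ⟦ ψ ⟧ μ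
  ⟦ φ ⇽ ψ ⟧ μ = ⟦ φ ⟧ μ A.⇽ ⟦ ψ ⟧ μ

  Valid : Sequent → Set (c ⊔ ℓ₂)
  Valid (φ ⊢ ψ) = ∀ μ → ⟦ φ ⟧ μ A.≤ ⟦ ψ ⟧ μ

AlgebraicallyCorresponds : ∀ c ℓ₁ ℓ₂ → Sequent → Sequent → Set (lsuc (c ⊔ ℓ₁ ⊔ ℓ₂))
AlgebraicallyCorresponds c ℓ₁ ℓ₂ s t = (A : BDRG c ℓ₁ ℓ₂) → Valid A s ⇔ Valid A t

Occurs : Var → Formula → Set
Occurs p (var q) = p ≡ q
Occurs p ⊤       = 𝟘
Occurs p ⊥       = 𝟘
Occurs p (φ ∧ ψ) = Occurs p φ ⊎ Occurs p ψ
Occurs p (φ ∨ ψ) = Occurs p φ ⊎ Occurs p ψ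
Occurs p (φ ⇾ ψ) = Occurs p φ ⊎ Occurs p ψ
Occurs p (φ • ψ) = Occurs p φ ⊎ Occurs p ψ
Occurs p (φ ⇽ ψ) = Occurs p φ ⊎ Occurs p ψ

Occursˢ : Var → Sequent → Set
Occursˢ p (φ ⊢ ψ) = Occurs p φ ⊎ Occurs p ψ

Occursˢˢ : Var → Supersequent → Set
Occursˢˢ p (Θ ⇒ s) = (Σ[ t ∈ Sequent ] t ∈ Θ × Occursˢ p t) ⊎ Occursˢ p s

-- Every occurrence of p is positive (negative); in particular both hold of a
-- formula in which p does not occur.
mutual
  Positive : Var → Formula → Set
  Positive p (var q) = 𝟙
  Positive p ⊤       = 𝟙
  Positive p ⊥       = 𝟙
  Positive p (φ ∧ ψ) = Positive p φ × Positive p ψ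
  Positive p (φ ∨ ψ) = Positive p φ × Positive p ψ
  Positive p (φ ⇾ ψ) = Negative p φ × Positive p ψ
  Positive p (φ • ψ) = Positive p φ × Positive p ψ
  Positive p (φ ⇽ ψ) = Positive p φ × Negative p ψ

  Negative : Var → Formula → Set
  Negative p (var q) = p ≢ q
  Negative p ⊤       = 𝟙
  Negative p ⊥       = 𝟙
  Negative p (φ ∧ ψ) = Negative p φ × Negative p ψ
  Negative p (φ ∨ ψ) = Negative p φ × Negative p ψ
  Negative p (φ ⇾ ψ) = Positive p φ × Negative p ψ
  Negative p (φ • ψ) = Negative p φ × Negative p ψ
  Negative p (φ ⇽ ψ) = Negative p φ × Positive p ψ

Positiveˢ : Var → Sequent → Set
Positiveˢ p (φ ⊢ ψ) = Negative p φ × Positive p ψ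

Negativeˢ : Var → Sequent → Set
Negativeˢ p (φ ⊢ ψ) = Positive p φ × Negative p ψ

_[_/_] : Formula → Formula → Var → Formula
var q   [ α / p ] = if does (q ≟ p) then α else var q
⊤       [ α / p ] = ⊤
⊥       [ α / p ] = ⊥
(φ ∧ ψ) [ α / p ] = φ [ α / p ] ∧ ψ [ α / p ]
(φ ∨ ψ) [ α / p ] = φ [ α / p ] ∨ ψ [ α / p ]
(φ ⇾ ψ) [ α / p ] = φ [ α / p ] ⇾ ψ [ α / p ]
(φ • ψ) [ α / p ] = φ [ α / p ] • ψ [ α / p ]
(φ ⇽ ψ) [ α / p ] = φ [ α / p ] ⇽ ψ [ α / p ]

_[_/_]ˢ : Sequent → Formula → Var → Sequent
(φ ⊢ ψ) [ α / p ]ˢ = φ [ α / p ] ⊢ ψ [ α / p ]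

-- No spurious unit is added to a nonempty join or meet: ⋁ (φ ∷ []) is φ itself.
⋁ : List Formula → Formula
⋁ []           = ⊥
⋁ (φ ∷ [])     = φ
⋁ (φ ∷ ψ ∷ φs) = φ ∨ ⋁ (ψ ∷ φs)

⋀ : List Formula → Formula
⋀ []           = ⊤
⋀ (φ ∷ [])     = φ
⋀ (φ ∷ ψ ∷ φs) = φ ∧ ⋀ (ψ ∷ φs)

private variable
  φ ψ γ : Formula
  s     : Sequent
  Γ     : List Sequent
  Θ Θ′  : Pred Sequent 0ℓ
  p     : Var

-- Replacement of a single assumption by a finite list of assumptions.
data _⇌_ : Sequent → List Sequent → Set where
  split-∧ : (γ ⊢ φ ∧ ψ) ⇌ ((γ ⊢ φ) ∷ (γ ⊢ ψ) ∷ [])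
  split-∨ : (φ ∨ ψ ⊢ γ) ⇌ ((φ ⊢ γ) ∷ (ψ ⊢ γ) ∷ [])
  res-⇾   : (ψ ⊢ φ ⇾ γ) ⇌ ((φ • ψ ⊢ γ) ∷ [])
  res-⇽   : (φ ⊢ γ ⇽ ψ) ⇌ ((φ • ψ ⊢ γ) ∷ [])

-- The same, introducing the variable p.
data _⇌[_]_ : Sequent → Var → List Sequent → Set where
  ⇾⊢₁ : (φ ⇾ ψ ⊢ γ) ⇌[ p ] ((var p ⊢ φ) ∷ (var p ⇾ ψ ⊢ γ) ∷ [])
  ⇾⊢₂ : (φ ⇾ ψ ⊢ γ) ⇌[ p ] ((ψ ⊢ var p) ∷ (φ ⇾ var p ⊢ γ) ∷ [])
  ⊢⇾₁ : (γ ⊢ φ ⇾ ψ) ⇌[ p ] ((φ ⊢ var p) ∷ (γ ⊢ var p ⇾ ψ) ∷ [])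
  ⊢⇾₂ : (γ ⊢ φ ⇾ ψ) ⇌[ p ] ((var p ⊢ ψ) ∷ (γ ⊢ φ ⇾ var p) ∷ [])
  ⊢•₁ : (φ ⊢ ψ • γ) ⇌[ p ] ((var p ⊢ ψ) ∷ (φ ⊢ var p • γ) ∷ [])
  ⊢•₂ : (φ ⊢ ψ • γ) ⇌[ p ] ((var p ⊢ γ) ∷ (φ ⊢ ψ • var p) ∷ [])
  •⊢₁ : (φ • ψ ⊢ γ) ⇌[ p ] ((φ ⊢ var p) ∷ (var p • ψ ⊢ γ) ∷ [])
  •⊢₂ : (φ • ψ ⊢ γ) ⇌[ p ] ((ψ ⊢ var p) ∷ (φ • var p ⊢ γ) ∷ [])
  ∧⊢₁ : (φ ∧ ψ ⊢ γ) ⇌[ p ] ((φ ⊢ var p) ∷ (var p ∧ ψ ⊢ γ) ∷ [])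
  ∧⊢₂ : (φ ∧ ψ ⊢ γ) ⇌[ p ] ((ψ ⊢ var p) ∷ (φ ∧ var p ⊢ γ) ∷ [])
  ⊢∨₁ : (φ ⊢ ψ ∨ γ) ⇌[ p ] ((var p ⊢ ψ) ∷ (φ ⊢ var p ∨ γ) ∷ [])
  ⊢∨₂ : (φ ⊢ ψ ∨ γ) ⇌[ p ] ((var p ⊢ γ) ∷ (φ ⊢ ψ ∨ var p) ∷ [])

-- Rules S // S′ without a freshness condition.
data _//_ : Supersequent → Supersequent → Set₁ where
  assumption : s ⇌ Γ → (｛ s ｝ ∪ Θ ⇒ γ ⊢ φ) // (⟨ Γ ⟩ ∪ Θ ⇒ γ ⊢ φ)
  concl-⇾    : (Θ ⇒ ψ ⊢ φ ⇾ γ) // (Θ ⇒ φ • ψ ⊢ γ)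
  concl-⇽    : (Θ ⇒ φ ⊢ γ ⇽ ψ) // (Θ ⇒ φ • ψ ⊢ γ)
  RAck : ∀ {φs Γ χ δ} →
    All (λ φ → ¬ Occurs p φ) φs →
    (∀ t → t ∈ Θ′ → ¬ Occursˢ p t) →
    All (Negativeˢ p) Γ →
    ¬ Occursˢ p (χ ⊢ δ) ⊎ Positiveˢ p (χ ⊢ δ) →
    (⟨ map (_⊢ var p) φs ⟩ ∪ ⟨ Γ ⟩ ∪ Θ′ ⇒ χ ⊢ δ)
      // (⟨ map _[ ⋁ φs / p ]ˢ Γ ⟩ ∪ Θ′ ⇒ (χ ⊢ δ) [ ⋁ φs / p ]ˢ)
  LAck : ∀ {φs Γ χ δ} →
    All (λ φ → ¬ Occurs p φ) φs →
    (∀ t → t ∈ Θ′ → ¬ Occursˢ p t) →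
    All (Positiveˢ p) Γ →
    ¬ Occursˢ p (χ ⊢ δ) ⊎ Negativeˢ p (χ ⊢ δ) →
    (⟨ map (var p ⊢_) φs ⟩ ∪ ⟨ Γ ⟩ ∪ Θ′ ⇒ χ ⊢ δ)
      // (⟨ map _[ ⋀ φs / p ]ˢ Γ ⟩ ∪ Θ′ ⇒ (χ ⊢ δ) [ ⋀ φs / p ]ˢ)

-- Rules S // S′ in which p has to be fresh.
data _//[_]_ : Supersequent → Var → Supersequent → Set₁ where
  approx   : s ⇌[ p ] Γ → (｛ s ｝ ∪ Θ ⇒ γ ⊢ φ) //[ p ] (⟨ Γ ⟩ ∪ Θ ⇒ γ ⊢ φ)
  concl-⊢ˡ : (Θ ⇒ φ ⊢ ψ) //[ p ] (｛ var p ⊢ φ ｝ ∪ Θ ⇒ var p ⊢ ψ)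
  concl-⊢ʳ : (Θ ⇒ φ ⊢ ψ) //[ p ] (｛ ψ ⊢ var p ｝ ∪ Θ ⇒ φ ⊢ var p)

-- All rules have one premiss, so a derivation is a sequence of supersequents.
-- Read downwards, a rule introducing p requires that p occurs nowhere in the
-- derivation so far.  Read upwards, p necessarily occurs already, and the
-- condition is that it is eliminated: it does not occur in the result.
mutual
  data Derivation (S : Supersequent) : Supersequent → Set₁ where
    premiss : Derivation S S
    set≋    : ∀ {T U} → Derivation S T → T ≋ U → Derivation S U
    down    : ∀ {T U} → Derivation S T → T // U → Derivation S U
    up      : ∀ {T U} → Derivation S T → U // T → Derivation S U
    down#   : ∀ {T U p} (d : Derivation S T) → All (λ V → ¬ Occursˢˢ p V) (lines d) →
              T //[ p ] U → Derivation S U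
    up#     : ∀ {T U p} → Derivation S T → ¬ Occursˢˢ p U →
              U //[ p ] T → Derivation S U

  lines : ∀ {S T} → Derivation S T → List Supersequent
  lines {S} premiss           = S ∷ []
  lines {T = U} (set≋ d _)    = U ∷ lines d
  lines {T = U} (down d _)    = U ∷ lines d
  lines {T = U} (up d _)      = U ∷ lines d
  lines {T = U} (down# d _ _) = U ∷ lines d
  lines {T = U} (up# d _ _)   = U ∷ lines d

DerivableRule : Sequent → Sequent → Set₁
DerivableRule s t = Derivation (∅ ⇒ s) (∅ ⇒ t)

{-# OPTIONS --safe #-}
module Submission where

-- The theorem is soundness of the calculus, read in both directions.  In a
-- fixed BDRG, call Θ ⇒ s valid if every assignment satisfying all sequents of
-- Θ satisfies s.  Each rule S // S′ preserves and reflects validity, hence so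
-- does every derivation; and ∅ ⇒ s is valid exactly when s is.
--
-- Splitting and residuation, of assumptions or of the conclusion, do not change
-- the assignments that satisfy them.  The other rules compare an assignment μ
-- with its update ν at the variable p:
--
--   * for a fresh p, the value of p in ν is that of the formula that p
--     approximates, and μ and ν satisfy the same sequents without p.  If μ
--     satisfies the sequent being approximated, then ν satisfies the new ones
--     (approximation-complete); the converse is monotonicity of the operations
--     (approximation-sound);
--
--   * for the Ackermann rules, the value of p in ν is that of α, so that ν
--     satisfies a sequent exactly when μ satisfies its substitution instance
--     (satisfies-[/]).  If μ satisfies the bounds on p, then μ and ν are
--     comparable at p, and the polarity conditions transfer the assumptions
--     from μ to ν and the conclusion from ν to μ (satisfies-monotone and
--     satisfies-antitone); sequents without p are satisfied by both or neither.

open import Defs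
open import Level using (Level; 0ℓ; _⊔_)
open import Data.Bool using (if_then_else_)
open import Data.Bool.Properties using (if-float)
open import Data.List using (List; []; _∷_; map)
open import Data.List.Relation.Unary.All as All using (All; []; _∷_)
open import Data.List.Relation.Unary.All.Properties using (map⁺; map⁻)
open import Data.Nat using (_≟_)
open import Data.Product using (_×_; _,_)
open import Data.Sum using (inj₁; inj₂; [_,_]; [_,_]′)
open import Function using (id; _∘_)
open import Function.Bundles using (_⇔_; mk⇔; Equivalence)
open import Function.Construct.Composition using (_⇔-∘_)
open import Function.Construct.Identity using (⇔-id)
open import Function.Construct.Symmetry using (⇔-sym)
open import Relation.Binary.Lattice using (BoundedLattice)
import Relation.Binary.Lattice.Properties.JoinSemilattice as JoinProperties
import Relation.Binary.Lattice.Properties.MeetSemilattice as MeetProperties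
open import Relation.Binary.PropositionalEquality
  using (_≡_; _≢_; refl; sym; trans; cong₂; subst; subst₂)
open import Relation.Nullary using (¬_; does; yes; no)
open import Relation.Nullary.Decidable using (dec-true; dec-false)
open import Relation.Unary using (Pred; _∈_; _∪_; ∅)

private variable
  p     : Var
  s     : Sequent
  Γ     : List Sequent
  S T   : Supersequent

-- Variables of rules and derivations

-- The formula for which an approximation rule substitutes the fresh variable.
approximated : s ⇌[ p ] Γ → Formula
approximated (⇾⊢₁ {φ = φ}) = φ
approximated (⇾⊢₂ {ψ = ψ}) = ψ
approximated (⊢⇾₁ {φ = φ}) = φ
approximated (⊢⇾₂ {ψ = ψ}) = ψ
approximated (⊢•₁ {ψ = ψ}) = ψ
approximated (⊢•₂ {γ = γ}) = γ
approximated (•⊢₁ {φ = φ}) = φ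
approximated (•⊢₂ {ψ = ψ}) = ψ
approximated (∧⊢₁ {φ = φ}) = φ
approximated (∧⊢₂ {ψ = ψ}) = ψ
approximated (⊢∨₁ {ψ = ψ}) = ψ
approximated (⊢∨₂ {γ = γ}) = γ

approximated-occurs : (r : s ⇌[ p ] Γ) → ∀ {q} → Occurs q (approximated r) → Occursˢ q s
approximated-occurs ⇾⊢₁ = inj₁ ∘ inj₁
approximated-occurs ⇾⊢₂ = inj₁ ∘ inj₂
approximated-occurs ⊢⇾₁ = inj₂ ∘ inj₁
approximated-occurs ⊢⇾₂ = inj₂ ∘ inj₂
approximated-occurs ⊢•₁ = inj₂ ∘ inj₁
approximated-occurs ⊢•₂ = inj₂ ∘ inj₂
approximated-occurs •⊢₁ = inj₁ ∘ inj₁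
approximated-occurs •⊢₂ = inj₁ ∘ inj₂
approximated-occurs ∧⊢₁ = inj₁ ∘ inj₁
approximated-occurs ∧⊢₂ = inj₁ ∘ inj₂
approximated-occurs ⊢∨₁ = inj₂ ∘ inj₁
approximated-occurs ⊢∨₂ = inj₂ ∘ inj₂

-- The end of a derivation is the first of its lines.
All-lines⇒end : ∀ {ℓ} {P : Pred Supersequent ℓ} (d : Derivation S T) → All P (lines d) → P T
All-lines⇒end premiss       = All.head
All-lines⇒end (set≋ _ _)    = All.head
All-lines⇒end (down _ _)    = All.head
All-lines⇒end (up _ _)      = All.head
All-lines⇒end (down# _ _ _) = All.head
All-lines⇒end (up# _ _ _)   = All.head

module Semantics {c ℓ₁ ℓ₂} (A : BDRG c ℓ₁ ℓ₂) where
  private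
    module A = BDRG A

    boundedLattice : BoundedLattice c ℓ₁ ℓ₂
    boundedLattice = record { isBoundedLattice = A.isBoundedLattice }

    module L = BoundedLattice boundedLattice

  open JoinProperties L.joinSemilattice using (∨-monotonic)
  open MeetProperties L.meetSemilattice using (∧-monotonic)
  open L using () renaming (refl to ≤-refl; trans to ≤-trans)

  Assignment : Set c
  Assignment = Var → A.Carrier

  private variable
    μ ν : Assignment

  -- Monotonicity of the residuated operations

  •-monotonic : ∀ {a a′ b b′} → a A.≤ a′ → b A.≤ b′ → a A.• b A.≤ a′ A.• b′
  •-monotonic a≤a′ b≤b′ =
    Equivalence.from (A.residual-⇽ _ _ _)
      (≤-trans a≤a′ (Equivalence.to (A.residual-⇽ _ _ _)
        (Equivalence.from (A.residual-⇾ _ _ _)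
          (≤-trans b≤b′ (Equivalence.to (A.residual-⇾ _ _ _) ≤-refl)))))

  ⇾-monotonic : ∀ {a a′ b b′} → a′ A.≤ a → b A.≤ b′ → a A.⇾ b A.≤ a′ A.⇾ b′
  ⇾-monotonic a′≤a b≤b′ = Equivalence.to (A.residual-⇾ _ _ _)
    (≤-trans (•-monotonic a′≤a ≤-refl)
      (≤-trans (Equivalence.from (A.residual-⇾ _ _ _) ≤-refl) b≤b′))

  ⇽-monotonic : ∀ {a a′ b b′} → a A.≤ a′ → b′ A.≤ b → a A.⇽ b A.≤ a′ A.⇽ b′
  ⇽-monotonic a≤a′ b′≤b = Equivalence.to (A.residual-⇽ _ _ _)
    (≤-trans (•-monotonic ≤-refl b′≤b)
      (≤-trans (Equivalence.from (A.residual-⇽ _ _ _) ≤-refl) a≤a′))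

  ≤-reflexive : ∀ {a b} → a ≡ b → a A.≤ b
  ≤-reflexive refl = ≤-refl

  -- Updating an assignment

  _[_≔_] : Assignment → Var → A.Carrier → Assignment
  (μ [ p ≔ a ]) q = if does (q ≟ p) then a else μ q

  update-eq : ∀ μ p a → (μ [ p ≔ a ]) p ≡ a
  update-eq μ p a rewrite dec-true (p ≟ p) refl = refl

  update-neq : ∀ μ {p q} a → q ≢ p → (μ [ p ≔ a ]) q ≡ μ q
  update-neq μ {p} {q} a q≢p rewrite dec-false (q ≟ p) q≢p = refl

  ⟦⟧-update : ∀ φ {p a} → ¬ Occurs p φ → ⟦_⟧ A φ (μ [ p ≔ a ]) ≡ ⟦_⟧ A φ μ
  ⟦⟧-update {μ} (var q) {a = a} p∉ = update-neq μ a (p∉ ∘ sym)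
  ⟦⟧-update ⊤       p∉ = refl
  ⟦⟧-update ⊥       p∉ = refl
  ⟦⟧-update (φ ∧ ψ) p∉ = cong₂ A._∧_ (⟦⟧-update φ (p∉ ∘ inj₁)) (⟦⟧-update ψ (p∉ ∘ inj₂))
  ⟦⟧-update (φ ∨ ψ) p∉ = cong₂ A._∨_ (⟦⟧-update φ (p∉ ∘ inj₁)) (⟦⟧-update ψ (p∉ ∘ inj₂))
  ⟦⟧-update (φ ⇾ ψ) p∉ = cong₂ A._⇾_ (⟦⟧-update φ (p∉ ∘ inj₁)) (⟦⟧-update ψ (p∉ ∘ inj₂))
  ⟦⟧-update (φ • ψ) p∉ = cong₂ A._•_ (⟦⟧-update φ (p∉ ∘ inj₁)) (⟦⟧-update ψ (p∉ ∘ inj₂))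
  ⟦⟧-update (φ ⇽ ψ) p∉ = cong₂ A._⇽_ (⟦⟧-update φ (p∉ ∘ inj₁)) (⟦⟧-update ψ (p∉ ∘ inj₂))

  ⟦⟧-[/] : ∀ φ {α p} → ⟦_⟧ A φ (μ [ p ≔ ⟦_⟧ A α μ ]) ≡ ⟦_⟧ A (φ [ α / p ]) μ
  ⟦⟧-[/] {μ} (var q) {α} {p} = sym (if-float (λ β → ⟦_⟧ A β μ) (does (q ≟ p)))
  ⟦⟧-[/] ⊤       = refl
  ⟦⟧-[/] ⊥       = refl
  ⟦⟧-[/] (φ ∧ ψ) = cong₂ A._∧_ (⟦⟧-[/] φ) (⟦⟧-[/] ψ)
  ⟦⟧-[/] (φ ∨ ψ) = cong₂ A._∨_ (⟦⟧-[/] φ) (⟦⟧-[/] ψ)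
  ⟦⟧-[/] (φ ⇾ ψ) = cong₂ A._⇾_ (⟦⟧-[/] φ) (⟦⟧-[/] ψ)
  ⟦⟧-[/] (φ • ψ) = cong₂ A._•_ (⟦⟧-[/] φ) (⟦⟧-[/] ψ)
  ⟦⟧-[/] (φ ⇽ ψ) = cong₂ A._⇽_ (⟦⟧-[/] φ) (⟦⟧-[/] ψ)

  -- Comparison of assignments that differ at one variable

  -- μ is below ν at p, and equal to ν at every other variable.
  _⊑[_]_ : Assignment → Var → Assignment → Set (c ⊔ ℓ₂)
  μ ⊑[ p ] ν = μ p A.≤ ν p × (∀ {q} → q ≢ p → μ q ≡ ν q)

  update-⊑ : ∀ {a} → a A.≤ μ p → (μ [ p ≔ a ]) ⊑[ p ] μ
  update-⊑ {μ} {p} {a} a≤ =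
    subst (A._≤ μ p) (sym (update-eq μ p a)) a≤ , update-neq μ a

  ⊑-update : ∀ {a} → μ p A.≤ a → μ ⊑[ p ] (μ [ p ≔ a ])
  ⊑-update {μ} {p} {a} ≤a =
    subst (μ p A.≤_) (sym (update-eq μ p a)) ≤a , sym ∘ update-neq μ a

  mutual
    positive-monotone : ∀ φ → Positive p φ → μ ⊑[ p ] ν → ⟦_⟧ A φ μ A.≤ ⟦_⟧ A φ ν
    positive-monotone {p} (var q) _ (μp≤νp , agree) with q ≟ p
    ... | yes refl = μp≤νp
    ... | no q≢p   = ≤-reflexive (agree q≢p)
    positive-monotone ⊤       _       _ = ≤-refl
    positive-monotone ⊥       _       _ = ≤-refl
    positive-monotone (φ ∧ ψ) (f , g) h = ∧-monotonic (positive-monotone φ f h) (positive-monotone ψ g h)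
    positive-monotone (φ ∨ ψ) (f , g) h = ∨-monotonic (positive-monotone φ f h) (positive-monotone ψ g h)
    positive-monotone (φ ⇾ ψ) (f , g) h = ⇾-monotonic (negative-antitone φ f h) (positive-monotone ψ g h)
    positive-monotone (φ • ψ) (f , g) h = •-monotonic (positive-monotone φ f h) (positive-monotone ψ g h)
    positive-monotone (φ ⇽ ψ) (f , g) h = ⇽-monotonic (positive-monotone φ f h) (negative-antitone ψ g h)

    negative-antitone : ∀ φ → Negative p φ → μ ⊑[ p ] ν → ⟦_⟧ A φ ν A.≤ ⟦_⟧ A φ μ
    negative-antitone (var q) p≢q (_ , agree) =
      ≤-reflexive (sym (agree (p≢q ∘ sym)))
    negative-antitone ⊤       _       _ = ≤-refl
    negative-antitone ⊥       _       _ = ≤-refl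
    negative-antitone (φ ∧ ψ) (f , g) h = ∧-monotonic (negative-antitone φ f h) (negative-antitone ψ g h)
    negative-antitone (φ ∨ ψ) (f , g) h = ∨-monotonic (negative-antitone φ f h) (negative-antitone ψ g h)
    negative-antitone (φ ⇾ ψ) (f , g) h = ⇾-monotonic (positive-monotone φ f h) (negative-antitone ψ g h)
    negative-antitone (φ • ψ) (f , g) h = •-monotonic (negative-antitone φ f h) (negative-antitone ψ g h)
    negative-antitone (φ ⇽ ψ) (f , g) h = ⇽-monotonic (negative-antitone φ f h) (positive-monotone ψ g h)

  -- Satisfaction

  Satisfies : Assignment → Sequent → Set ℓ₂
  Satisfies μ (φ ⊢ ψ) = ⟦_⟧ A φ μ A.≤ ⟦_⟧ A ψ μ

  infix 4 _⊩_
  _⊩_ : Assignment → Pred Sequent 0ℓ → Set ℓ₂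
  μ ⊩ Θ = ∀ t → t ∈ Θ → Satisfies μ t

  -- Validity of a supersequent is the local consequence relation: an assignment
  -- satisfying all the assumptions satisfies the conclusion.
  Validˢˢ : Supersequent → Set (c ⊔ ℓ₂)
  Validˢˢ (Θ ⇒ s) = ∀ μ → μ ⊩ Θ → Satisfies μ s

  -- Both sides are equal as types, since values are propositionally equal.
  satisfies-update : ∀ t {a} → ¬ Occursˢ p t → Satisfies (μ [ p ≔ a ]) t ≡ Satisfies μ t
  satisfies-update (φ ⊢ ψ) p∉ =
    cong₂ A._≤_ (⟦⟧-update φ (p∉ ∘ inj₁)) (⟦⟧-update ψ (p∉ ∘ inj₂))

  satisfies-[/] : ∀ t {α} → Satisfies (μ [ p ≔ ⟦_⟧ A α μ ]) t ≡ Satisfies μ (t [ α / p ]ˢ)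
  satisfies-[/] (φ ⊢ ψ) = cong₂ A._≤_ (⟦⟧-[/] φ) (⟦⟧-[/] ψ)

  satisfies-monotone : ∀ t → Positiveˢ p t → μ ⊑[ p ] ν → Satisfies μ t → Satisfies ν t
  satisfies-monotone (φ ⊢ ψ) (f , g) h φ≤ψ =
    ≤-trans (negative-antitone φ f h) (≤-trans φ≤ψ (positive-monotone ψ g h))

  satisfies-antitone : ∀ t → Negativeˢ p t → μ ⊑[ p ] ν → Satisfies ν t → Satisfies μ t
  satisfies-antitone (φ ⊢ ψ) (f , g) h φ≤ψ =
    ≤-trans (positive-monotone φ f h) (≤-trans φ≤ψ (negative-antitone ψ g h))

  ⊩-update : ∀ {Θ a} → (∀ t → t ∈ Θ → ¬ Occursˢ p t) → μ ⊩ Θ → (μ [ p ≔ a ]) ⊩ Θ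
  ⊩-update p∉ μ⊩Θ t t∈Θ = subst id (sym (satisfies-update t (p∉ t t∈Θ))) (μ⊩Θ t t∈Θ)

  ⊩-∪ : ∀ {Θ Θ′} → μ ⊩ Θ → μ ⊩ Θ′ → μ ⊩ Θ ∪ Θ′
  ⊩-∪ μ⊩Θ μ⊩Θ′ t = [ μ⊩Θ t , μ⊩Θ′ t ]

  ⊩-All : All (Satisfies μ) Γ → μ ⊩ ⟨ Γ ⟩
  ⊩-All all t = All.lookup all

  ⊩-list : ∀ {Θ} → μ ⊩ ⟨ Γ ⟩ ∪ Θ → All (Satisfies μ) Γ
  ⊩-list μ⊩ = All.tabulate (λ {t} t∈Γ → μ⊩ t (inj₁ t∈Γ))

  ⊩-rest : ∀ {Θ Θ′} → μ ⊩ Θ ∪ Θ′ → μ ⊩ Θ′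
  ⊩-rest μ⊩ t t∈ = μ⊩ t (inj₂ t∈)

  -- Splitting and residuation

  replacement-sound : s ⇌ Γ → All (Satisfies μ) Γ ⇔ Satisfies μ s
  replacement-sound split-∧ = mk⇔
    (λ { (h ∷ k ∷ []) → L.∧-greatest h k })
    (λ h → ≤-trans h (L.x∧y≤x _ _) ∷ ≤-trans h (L.x∧y≤y _ _) ∷ [])
  replacement-sound split-∨ = mk⇔
    (λ { (h ∷ k ∷ []) → L.∨-least h k })
    (λ h → ≤-trans (L.x≤x∨y _ _) h ∷ ≤-trans (L.y≤x∨y _ _) h ∷ [])
  replacement-sound res-⇾ = mk⇔
    (λ { (h ∷ []) → Equivalence.to (A.residual-⇾ _ _ _) h })
    (λ h → Equivalence.from (A.residual-⇾ _ _ _) h ∷ [])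
  replacement-sound res-⇽ = mk⇔
    (λ { (h ∷ []) → Equivalence.to (A.residual-⇽ _ _ _) h })
    (λ h → Equivalence.from (A.residual-⇽ _ _ _) h ∷ [])

  -- Approximation

  approximation-sound : s ⇌[ p ] Γ → All (Satisfies μ) Γ → Satisfies μ s
  approximation-sound ⇾⊢₁ (h ∷ k ∷ []) = ≤-trans (⇾-monotonic h ≤-refl) k
  approximation-sound ⇾⊢₂ (h ∷ k ∷ []) = ≤-trans (⇾-monotonic ≤-refl h) k
  approximation-sound ⊢⇾₁ (h ∷ k ∷ []) = ≤-trans k (⇾-monotonic h ≤-refl)
  approximation-sound ⊢⇾₂ (h ∷ k ∷ []) = ≤-trans k (⇾-monotonic ≤-refl h)
  approximation-sound ⊢•₁ (h ∷ k ∷ []) = ≤-trans k (•-monotonic h ≤-refl)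
  approximation-sound ⊢•₂ (h ∷ k ∷ []) = ≤-trans k (•-monotonic ≤-refl h)
  approximation-sound •⊢₁ (h ∷ k ∷ []) = ≤-trans (•-monotonic h ≤-refl) k
  approximation-sound •⊢₂ (h ∷ k ∷ []) = ≤-trans (•-monotonic ≤-refl h) k
  approximation-sound ∧⊢₁ (h ∷ k ∷ []) = ≤-trans (∧-monotonic h ≤-refl) k
  approximation-sound ∧⊢₂ (h ∷ k ∷ []) = ≤-trans (∧-monotonic ≤-refl h) k
  approximation-sound ⊢∨₁ (h ∷ k ∷ []) = ≤-trans k (∨-monotonic h ≤-refl)
  approximation-sound ⊢∨₂ (h ∷ k ∷ []) = ≤-trans k (∨-monotonic ≤-refl h)

  -- The converse holds when p has the value of the formula it approximates.
  approximation-complete : (r : s ⇌[ p ] Γ) → μ p ≡ ⟦_⟧ A (approximated r) μ →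
                           Satisfies μ s → All (Satisfies μ) Γ
  approximation-complete ⇾⊢₁ eq h =
    ≤-reflexive eq ∷ subst (λ a → a A.⇾ _ A.≤ _) (sym eq) h ∷ []
  approximation-complete ⇾⊢₂ eq h =
    ≤-reflexive (sym eq) ∷ subst (λ a → _ A.⇾ a A.≤ _) (sym eq) h ∷ []
  approximation-complete ⊢⇾₁ eq h =
    ≤-reflexive (sym eq) ∷ subst (λ a → _ A.≤ a A.⇾ _) (sym eq) h ∷ []
  approximation-complete ⊢⇾₂ eq h =
    ≤-reflexive eq ∷ subst (λ a → _ A.≤ _ A.⇾ a) (sym eq) h ∷ []
  approximation-complete ⊢•₁ eq h =
    ≤-reflexive eq ∷ subst (λ a → _ A.≤ a A.• _) (sym eq) h ∷ []
  approximation-complete ⊢•₂ eq h =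
    ≤-reflexive eq ∷ subst (λ a → _ A.≤ _ A.• a) (sym eq) h ∷ []
  approximation-complete •⊢₁ eq h =
    ≤-reflexive (sym eq) ∷ subst (λ a → a A.• _ A.≤ _) (sym eq) h ∷ []
  approximation-complete •⊢₂ eq h =
    ≤-reflexive (sym eq) ∷ subst (λ a → _ A.• a A.≤ _) (sym eq) h ∷ []
  approximation-complete ∧⊢₁ eq h =
    ≤-reflexive (sym eq) ∷ subst (λ a → a A.∧ _ A.≤ _) (sym eq) h ∷ []
  approximation-complete ∧⊢₂ eq h =
    ≤-reflexive (sym eq) ∷ subst (λ a → _ A.∧ a A.≤ _) (sym eq) h ∷ []
  approximation-complete ⊢∨₁ eq h =
    ≤-reflexive eq ∷ subst (λ a → _ A.≤ a A.∨ _) (sym eq) h ∷ []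
  approximation-complete ⊢∨₂ eq h =
    ≤-reflexive eq ∷ subst (λ a → _ A.≤ _ A.∨ a) (sym eq) h ∷ []

  -- A variable that does not occur in φ can be given the value of φ.
  update-fresh : ∀ φ → ¬ Occurs p φ →
                 (μ [ p ≔ ⟦_⟧ A φ μ ]) p ≡ ⟦_⟧ A φ (μ [ p ≔ ⟦_⟧ A φ μ ])
  update-fresh {p} {μ} φ p∉ = trans (update-eq μ p _) (sym (⟦⟧-update φ p∉))

  fresh-rule-sound : S //[ p ] T → ¬ Occursˢˢ p S → Validˢˢ S ⇔ Validˢˢ T
  fresh-rule-sound {p = p} (approx {s = s} r) p∉ = mk⇔
    (λ valid μ μ⊩ → valid μ
      (⊩-∪ (λ { _ refl → approximation-sound r (⊩-list μ⊩) }) (⊩-rest μ⊩)))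
    (λ valid μ μ⊩ →
      let θ   = approximated r
          ν⊩  = ⊩-update {a = ⟦_⟧ A θ μ} (λ t t∈ o → p∉ (inj₁ (t , t∈ , o))) μ⊩
          p∉θ = λ o → p∉ (inj₁ (s , inj₁ refl , approximated-occurs r o))
      in subst id (satisfies-update _ (p∉ ∘ inj₂))
           (valid (μ [ p ≔ ⟦_⟧ A θ μ ])
             (⊩-∪ (⊩-All (approximation-complete r (update-fresh θ p∉θ)
                            (ν⊩ s (inj₁ refl))))
                  (⊩-rest ν⊩))))
  fresh-rule-sound {p = p} (concl-⊢ˡ {φ = φ} {ψ = ψ}) p∉ = mk⇔
    (λ valid μ μ⊩ → ≤-trans (μ⊩ _ (inj₁ refl)) (valid μ (⊩-rest μ⊩)))
    (λ valid μ μ⊩ →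
      let p≡φ = update-fresh φ (p∉ ∘ inj₂ ∘ inj₁)
      in subst₂ A._≤_ (update-eq μ p _) (⟦⟧-update ψ (p∉ ∘ inj₂ ∘ inj₂))
           (valid (μ [ p ≔ ⟦_⟧ A φ μ ])
             (⊩-∪ (λ { _ refl → ≤-reflexive p≡φ })
                  (⊩-update (λ t t∈ o → p∉ (inj₁ (t , t∈ , o))) μ⊩))))
  fresh-rule-sound {p = p} (concl-⊢ʳ {φ = φ} {ψ = ψ}) p∉ = mk⇔
    (λ valid μ μ⊩ → ≤-trans (valid μ (⊩-rest μ⊩)) (μ⊩ _ (inj₁ refl)))
    (λ valid μ μ⊩ →
      let p≡ψ = update-fresh ψ (p∉ ∘ inj₂ ∘ inj₂)
      in subst₂ A._≤_ (⟦⟧-update φ (p∉ ∘ inj₂ ∘ inj₁)) (update-eq μ p _)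
           (valid (μ [ p ≔ ⟦_⟧ A ψ μ ])
             (⊩-∪ (λ { _ refl → ≤-reflexive (sym p≡ψ) })
                  (⊩-update (λ t t∈ o → p∉ (inj₁ (t , t∈ , o))) μ⊩))))

  -- Ackermann rules

  ⋁-upper : ∀ φs → All (λ φ → ⟦_⟧ A φ μ A.≤ ⟦_⟧ A (⋁ φs) μ) φs
  ⋁-upper []           = []
  ⋁-upper (φ ∷ [])     = ≤-refl ∷ []
  ⋁-upper (φ ∷ ψ ∷ φs) =
    L.x≤x∨y _ _ ∷ All.map (λ h → ≤-trans h (L.y≤x∨y _ _)) (⋁-upper (ψ ∷ φs))

  ⋁-least : ∀ {φs a} → All (λ φ → ⟦_⟧ A φ μ A.≤ a) φs → ⟦_⟧ A (⋁ φs) μ A.≤ a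
  ⋁-least []           = L.minimum _
  ⋁-least (h ∷ [])     = h
  ⋁-least (h ∷ k ∷ hs) = L.∨-least h (⋁-least (k ∷ hs))

  ⋀-lower : ∀ φs → All (λ φ → ⟦_⟧ A (⋀ φs) μ A.≤ ⟦_⟧ A φ μ) φs
  ⋀-lower []           = []
  ⋀-lower (φ ∷ [])     = ≤-refl ∷ []
  ⋀-lower (φ ∷ ψ ∷ φs) =
    L.x∧y≤x _ _ ∷ All.map (≤-trans (L.x∧y≤y _ _)) (⋀-lower (ψ ∷ φs))

  ⋀-greatest : ∀ {φs a} → All (λ φ → a A.≤ ⟦_⟧ A φ μ) φs → a A.≤ ⟦_⟧ A (⋀ φs) μ
  ⋀-greatest []           = L.maximum _
  ⋀-greatest (h ∷ [])     = h
  ⋀-greatest (h ∷ k ∷ hs) = L.∧-greatest h (⋀-greatest (k ∷ hs))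

  -- The common form of both Ackermann rules.  Δ consists of the bounds on p, and
  -- α solves them; for every other solution, the assumptions Γ pass to the
  -- solution α, and the conclusion s passes back.
  ackermann : ∀ {α Δ Γ Θ s} →
    (∀ μ → All (Satisfies (μ [ p ≔ ⟦_⟧ A α μ ])) Δ) →
    (∀ μ → All (Satisfies μ) Δ →
       All (λ t → Satisfies μ t → Satisfies (μ [ p ≔ ⟦_⟧ A α μ ]) t) Γ
       × (Satisfies (μ [ p ≔ ⟦_⟧ A α μ ]) s → Satisfies μ s)) →
    (∀ t → t ∈ Θ → ¬ Occursˢ p t) →
    Validˢˢ (⟨ Δ ⟩ ∪ ⟨ Γ ⟩ ∪ Θ ⇒ s)
      ⇔ Validˢˢ (⟨ map _[ α / p ]ˢ Γ ⟩ ∪ Θ ⇒ s [ α / p ]ˢ)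
  ackermann {s = s} solution transfer p∉Θ = mk⇔
    (λ valid μ μ⊩ → subst id (satisfies-[/] s)
      (valid _
        (⊩-∪ (⊩-All (solution μ))
          (⊩-∪ (⊩-All (All.map (λ {t} → subst id (sym (satisfies-[/] t))) (map⁻ (⊩-list μ⊩))))
               (⊩-update p∉Θ (⊩-rest μ⊩))))))
    (λ valid μ μ⊩ →
      let (Γ-transfer , s-transfer) = transfer μ (⊩-list μ⊩)
          μ⊩Γ∪Θ = ⊩-rest μ⊩
          νΓ    = All.zipWith (λ (f , h) → f h) (Γ-transfer , ⊩-list μ⊩Γ∪Θ)
      in s-transfer (subst id (sym (satisfies-[/] s))
           (valid μ
             (⊩-∪ (⊩-All (map⁺ (All.map (λ {t} → subst id (satisfies-[/] t)) νΓ)))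
                  (⊩-rest μ⊩Γ∪Θ)))))

  -- Soundness of the calculus

  rule-sound : S // T → Validˢˢ S ⇔ Validˢˢ T
  rule-sound (assumption r) = mk⇔
    (λ valid μ μ⊩ → valid μ
      (⊩-∪ (λ { _ refl → Equivalence.to (replacement-sound r) (⊩-list μ⊩) }) (⊩-rest μ⊩)))
    (λ valid μ μ⊩ → valid μ
      (⊩-∪ (⊩-All (Equivalence.from (replacement-sound r) (μ⊩ _ (inj₁ refl)))) (⊩-rest μ⊩)))
  rule-sound concl-⇾ = mk⇔
    (λ valid μ μ⊩ → Equivalence.from (A.residual-⇾ _ _ _) (valid μ μ⊩))
    (λ valid μ μ⊩ → Equivalence.to (A.residual-⇾ _ _ _) (valid μ μ⊩))
  rule-sound concl-⇽ = mk⇔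
    (λ valid μ μ⊩ → Equivalence.from (A.residual-⇽ _ _ _) (valid μ μ⊩))
    (λ valid μ μ⊩ → Equivalence.to (A.residual-⇽ _ _ _) (valid μ μ⊩))
  rule-sound (RAck {p = p} {φs = φs} {χ = χ} {δ = δ} p∉φs p∉Θ neg pos) = ackermann {s = χ ⊢ δ}
    (λ μ → map⁺ (All.zipWith
      (λ {φ} (p∉φ , φ≤α) → subst₂ A._≤_ (sym (⟦⟧-update φ p∉φ)) (sym (update-eq μ p _)) φ≤α)
      (p∉φs , ⋁-upper φs)))
    (λ μ bounds →
      let ν⊑μ = update-⊑ (⋁-least (map⁻ bounds))
      in All.map (λ {t} n → satisfies-antitone t n ν⊑μ) neg
       , [ (λ p∉ → subst id (satisfies-update (χ ⊢ δ) p∉))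
         , (λ f → satisfies-monotone (χ ⊢ δ) f ν⊑μ) ]′ pos)
    p∉Θ
  rule-sound (LAck {p = p} {φs = φs} {χ = χ} {δ = δ} p∉φs p∉Θ pos neg) = ackermann {s = χ ⊢ δ}
    (λ μ → map⁺ (All.zipWith
      (λ {φ} (p∉φ , α≤φ) → subst₂ A._≤_ (sym (update-eq μ p _)) (sym (⟦⟧-update φ p∉φ)) α≤φ)
      (p∉φs , ⋀-lower φs)))
    (λ μ bounds →
      let μ⊑ν = ⊑-update (⋀-greatest (map⁻ bounds))
      in All.map (λ {t} f → satisfies-monotone t f μ⊑ν) pos
       , [ (λ p∉ → subst id (satisfies-update (χ ⊢ δ) p∉))
         , (λ n → satisfies-antitone (χ ⊢ δ) n μ⊑ν) ]′ neg)
    p∉Θ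

  ≋-sound : S ≋ T → Validˢˢ S ⇔ Validˢˢ T
  ≋-sound ((Θ⊆Θ′ , Θ′⊆Θ) , refl) = mk⇔
    (λ valid μ μ⊩ → valid μ (λ t t∈ → μ⊩ t (Θ⊆Θ′ t∈)))
    (λ valid μ μ⊩ → valid μ (λ t t∈ → μ⊩ t (Θ′⊆Θ t∈)))

  derivation-sound : Derivation S T → Validˢˢ S ⇔ Validˢˢ T
  derivation-sound premiss        = ⇔-id _
  derivation-sound (set≋ d e)     = ≋-sound e ⇔-∘ derivation-sound d
  derivation-sound (down d r)     = rule-sound r ⇔-∘ derivation-sound d
  derivation-sound (up d r)       = ⇔-sym (rule-sound r) ⇔-∘ derivation-sound d
  derivation-sound (down# d p∉ r) =
    fresh-rule-sound r (All-lines⇒end d p∉) ⇔-∘ derivation-sound d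
  derivation-sound (up# d p∉ r)   =
    ⇔-sym (fresh-rule-sound r p∉) ⇔-∘ derivation-sound d

  valid-∅ : ∀ s → Valid A s ⇔ Validˢˢ (∅ ⇒ s)
  valid-∅ (φ ⊢ ψ) = mk⇔ (λ valid μ _ → valid μ) (λ valid μ → valid μ (λ _ ()))

proposition1 : ∀ {c ℓ₁ ℓ₂ : Level} (φ ψ χ δ : Formula) →
    SISequent (φ ⊢ ψ) → •Sequent (χ ⊢ δ) →
    DerivableRule (φ ⊢ ψ) (χ ⊢ δ) →
    AlgebraicallyCorresponds c ℓ₁ ℓ₂ (φ ⊢ ψ) (χ ⊢ δ)
proposition1 φ ψ χ δ _ _ d A =
  ⇔-sym (valid-∅ (χ ⊢ δ)) ⇔-∘ (derivation-sound d ⇔-∘ valid-∅ (φ ⊢ ψ))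
  where open Semantics A
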